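{- For every integer $n\geq 2$ and every integer $b\in\{1,\dots,n-1\}$, there exists a connected irreducible graph of order $n$ and metric dimension $b$.
   Context: Graphs are finite, simple and undirected; the order of a graph is its number of vertices; $d_G(x,y)$ is the distance between $x$ and $y$ in $G$. A vertex $w$ resolves a pair of vertices $u,v$ if $d_G(u,w)\neq d_G(v,w)$. A set $W\subseteq V(G)$ is a resolving set for $G$ if every pair of distinct vertices of $G$ is resolved by some vertex of $W$. The metric dimension $\beta(G)$ is the minimum cardinality of a resolving set for $G$ (with $\beta(K_1)=0$). The threshold dimension is $\tau(G)=\min\{\beta(H): H \text{ contains } G \text{ as a spanning subgraph}\}$, i.e. the minimum metric dimension among all graphs $H$ with $V(H)=V(G)$ and $E(G)\subseteq E(H)$. A graph $G$ is irreducible if $\tau(G)=\beta(G)$. -}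

module Defs where

open import Data.Fin.Base using (Fin)
open import Data.Fin.Subset using (Subset; _∈_; ∣_∣)
open import Data.Nat.Base using (ℕ; zero; suc; _≤_)
open import Data.Product.Base using (∃; ∃₂; _×_)
open import Level using (Level; 0ℓ)
open import Relation.Binary.Core using (Rel; _⇒_)
open import Relation.Binary.Definitions using (Decidable; Irreflexive; Symmetric)
open import Relation.Binary.PropositionalEquality.Core using (_≡_; _≢_)
open import Relation.Nullary.Construct.Add.Supremum using (_⁺; ⊤⁺; [_])
open import Relation.Nullary.Negation.Core using (¬_)

IsMinimum : {ℓ : Level} → (ℕ → Set ℓ) → ℕ → Set ℓ
IsMinimum P m = P m × (∀ k → P k → m ≤ k)

-- A graph of order n has vertex set Fin n.
record Graph (n : ℕ) : Set₁ where
  field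
    Adj    : Rel (Fin n) 0ℓ
    sym    : Symmetric Adj
    irrefl : Irreflexive _≡_ Adj
    adj?   : Decidable Adj

open Graph public using (Adj)

data Walk {n : ℕ} (G : Graph n) : Fin n → Fin n → ℕ → Set where
  []  : ∀ {x} → Walk G x x zero
  _∷_ : ∀ {x y z k} → Adj G x y → Walk G y z k → Walk G x z (suc k)

Connected : {n : ℕ} → Graph n → Set
Connected G = ∀ x y → ∃ (Walk G x y)

-- Distance G x y d means d_G(x,y) = d. A shortest walk
-- repeats no vertex, so walks and paths give the same distance. Vertices in
-- different components are at distance ⊤⁺ (infinity).
data Distance {n : ℕ} (G : Graph n) (x y : Fin n) : ℕ ⁺ → Set where
  finite   : ∀ {k} → IsMinimum (Walk G x y) k → Distance G x y [ k ]
  infinite : (∀ k → ¬ Walk G x y k) → Distance G x y ⊤⁺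

Resolves : {n : ℕ} → Graph n → Fin n → Fin n → Fin n → Set
Resolves G w u v = ∃₂ λ d e → Distance G u w d × Distance G v w e × d ≢ e

Resolving : {n : ℕ} → Graph n → Subset n → Set
Resolving G W = ∀ u v → u ≢ v → ∃ λ w → w ∈ W × Resolves G w u v

-- β(G) = b, as a relation.
MetricDimension : {n : ℕ} → Graph n → ℕ → Set
MetricDimension G = IsMinimum λ k → ∃ λ W → Resolving G W × ∣ W ∣ ≡ k

-- Both graphs have vertex set Fin n, so every such subgraph is spanning.
SpanningSubgraph : {n : ℕ} → Graph n → Graph n → Set
SpanningSubgraph G H = Adj G ⇒ Adj H

-- τ(G) = t, as a relation.
ThresholdDimension : {n : ℕ} → Graph n → ℕ → Set₁
ThresholdDimension G =
  IsMinimum λ k → ∃ λ H → SpanningSubgraph G H × MetricDimension H k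

Irreducible : {n : ℕ} → Graph n → Set₁
Irreducible G = ∃ λ t → ThresholdDimension G t × MetricDimension G t

{-# OPTIONS --safe #-}

-- G is irreducible as soon as no supergraph of G (G included) has a resolving
-- set with fewer than β(G) vertices. The core graph on b + r vertices
-- (r ≤ 2 ^ b) is a clique of order r, one of whose vertices is universal,
-- together with b further vertices in which the vertices of the clique have
-- distinct neighbourhoods; these b vertices resolve it.
--
-- * n ≤ b + 2 ^ b: with a universal vertex all distances are at most 2, so
--   resolving depends on adjacency only, and adding one edge raises the metric
--   dimension by at most 1. Take a supergraph of the core which is edge-maximal
--   among those of dimension at most b. A supergraph of it of dimension below b
--   would have dimension at most b even after adding another edge, or else be
--   complete and have dimension n - 1 ≥ b.
--
-- * n > b + 2 ^ b: take r = 2 ^ (b - 1) + 1 and append a path at a resolving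
--   vertex, which does not raise the dimension. The distances from one
--   vertex to those of a clique take at most two values, so k vertices do not
--   resolve a clique of order greater than 2 ^ k.
module Submission where

open import Defs
open import Data.Nat.Base using (ℕ; _≤_; _∸_)
open import Data.Product.Base using (∃; _×_)

open import Data.Empty using (⊥; ⊥-elim)
open import Data.Fin.Base
  using (Fin; zero; suc; opposite; combine; quotient; remainder; finToFun; inject≤; splitAt; _↑ˡ_; _↑ʳ_)
import Data.Fin.Properties as Fin
open import Data.Fin.Subset as Subset
  using (Subset; _∈_; _∉_; _⊂_; _⊃_; ∣_∣; ⁅_⁆; _∪_; _-_; inside; outside)
open import Data.Fin.Subset.Induction using (⊃-wellFounded)
open import Data.Fin.Subset.Properties
  using (_∈?_; _⊂?_; anySubset?; x∈⁅x⁆; x∈p∪q⁺; ∪-identityʳ; ∣⊥∣≡0; x∈p∧x≢y⇒x∈p-y; x∈p⇒∣p-x∣<∣p∣)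
open import Data.Nat.Base using (zero; suc; _+_; _*_; _^_; _<_; z≤n; s≤s; s≤s⁻¹; z<s; s<s)
import Data.Nat.Properties as ℕ
open import Data.Product.Base using (_,_; proj₁; proj₂; uncurry)
open import Data.Sum.Base using (_⊎_; inj₁; inj₂; swap)
open import Data.Vec.Base using ([]; _∷_; here; there; lookup; tabulate)
open import Data.Vec.Properties using ([]=⇒lookup; lookup⇒[]=; lookup∘tabulate)
open import Function.Base using (_∘_; id)
open import Induction.WellFounded using (Acc; acc)
open import Relation.Binary.Definitions using (tri<; tri≈; tri>)
open import Relation.Binary.PropositionalEquality
  using (_≡_; _≢_; refl; sym; trans; cong; cong₂; subst; ≢-sym)
open import Relation.Nullary.Construct.Add.Supremum using ([_])
open import Relation.Nullary.Decidable
  using (Dec; yes; no; does; map′; dec-true; ¬?; _×-dec_; _⊎-dec_; _→-dec_)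
open import Relation.Nullary.Negation using (¬_; contradiction)
import Relation.Unary as Unary

-- Distances

least : ∀ {P : ℕ → Set} → Unary.Decidable P → ∀ k → P k → ∃ (IsMinimum P)
least P? zero p = zero , p , λ _ _ → z≤n
least P? (suc k) p with P? zero
... | yes p₀ = zero , p₀ , λ _ _ → z≤n
... | no ¬p₀ with m , pm , min ← least (P? ∘ suc) k p =
  suc m , pm , λ { zero q → contradiction q ¬p₀ ; (suc j) q → s≤s (min j q) }

walk? : ∀ {n} (G : Graph n) k x y → Dec (Walk G x y k)
walk? G zero x y = map′ (λ { refl → [] }) (λ { [] → refl }) (x Fin.≟ y)
walk? G (suc k) x y =
  map′ (λ { (_ , e , p) → e ∷ p }) (λ { (e ∷ p) → _ , e , p })
    (Fin.any? λ z → Graph.adj? G x z ×-dec walk? G k z y)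

distance : ∀ {n} {G : Graph n} → Connected G → ∀ x y → ∃ (IsMinimum (Walk G x y))
distance {G = G} con x y = uncurry (least λ k → walk? G k x y) (con x y)

Distance-unique : ∀ {n} {G : Graph n} {x y d e} → Distance G x y d → Distance G x y e → d ≡ e
Distance-unique (finite (p , p≤)) (finite (q , q≤)) = cong [_] (ℕ.≤-antisym (p≤ _ q) (q≤ _ p))
Distance-unique (finite (p , _)) (infinite no-walk) = contradiction p (no-walk _)
Distance-unique (infinite no-walk) (finite (q , _)) = contradiction q (no-walk _)
Distance-unique (infinite _) (infinite _) = refl

Adj⇒≢ : ∀ {n} (G : Graph n) {x y} → Adj G x y → x ≢ y
Adj⇒≢ G e x≡y = Graph.irrefl G x≡y e

distance-1 : ∀ {n} {G : Graph n} {x y} → Adj G x y → Distance G x y [ 1 ]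
distance-1 {G = G} {x} {y} e = finite (e ∷ [] , min)
  where
  min : ∀ k → Walk G x y k → 1 ≤ k
  min zero [] = contradiction refl (Adj⇒≢ G e)
  min (suc k) _ = s≤s z≤n

distance-2 : ∀ {n} {G : Graph n} {x y z} → x ≢ z → ¬ Adj G x z →
  Adj G x y → Adj G y z → Distance G x z [ 2 ]
distance-2 {G = G} {x} {y} {z} x≢z ¬xz xy yz = finite (xy ∷ yz ∷ [] , min)
  where
  min : ∀ k → Walk G x z k → 2 ≤ k
  min zero [] = contradiction refl x≢z
  min (suc zero) (e ∷ []) = contradiction e ¬xz
  min (suc (suc k)) _ = s≤s (s≤s z≤n)

-- A strict inequality between distances to `w`, phrased by walks alone: it transfers along maps of
-- walks and also covers the case that no walk leads from `v` to `w`.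
Closer : ∀ {n} → Graph n → Fin n → Fin n → Fin n → Set
Closer G w u v = ∃ λ k → Walk G u w k × (∀ j → j ≤ k → ¬ Walk G v w j)

Resolves-sym : ∀ {n} {G : Graph n} {w u v} → Resolves G w u v → Resolves G w v u
Resolves-sym (d , e , du , ev , d≢e) = e , d , ev , du , ≢-sym d≢e

Closer⇒Resolves : ∀ {n} {G : Graph n} → Connected G → ∀ {w u v} → Closer G w u v → Resolves G w u v
Closer⇒Resolves con {w} {u} {v} (k , p , far)
  with d , du ← distance con u w | e , ev ← distance con v w =
  [ d ] , [ e ] , finite du , finite ev ,
  λ { refl → far d (proj₂ du k p) (proj₁ ev) }

Resolves⇒Closer : ∀ {n} {G : Graph n} {w u v} → Resolves G w u v → Closer G w u v ⊎ Closer G w v u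
Resolves⇒Closer (_ , _ , finite {d} (p , p≤) , finite {e} (q , q≤) , d≢e) with ℕ.<-cmp d e
... | tri< d<e _ _ = inj₁ (d , p , λ j j≤d r → ℕ.<⇒≱ d<e (ℕ.≤-trans (q≤ j r) j≤d))
... | tri≈ _ refl _ = contradiction refl d≢e
... | tri> _ _ e<d = inj₂ (e , q , λ j j≤e r → ℕ.<⇒≱ e<d (ℕ.≤-trans (p≤ j r) j≤e))
Resolves⇒Closer (_ , _ , finite (p , _) , infinite none , _) = inj₁ (_ , p , λ j _ → none j)
Resolves⇒Closer (_ , _ , infinite none , finite (q , _) , _) = inj₂ (_ , q , λ j _ → none j)
Resolves⇒Closer (_ , _ , infinite _ , infinite _ , d≢e) = contradiction refl d≢e

self-resolves : ∀ {n} {G : Graph n} → Connected G → ∀ {u v} → u ≢ v → Resolves G u u v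
self-resolves con u≢v = Closer⇒Resolves con (0 , [] , λ { zero _ [] → u≢v refl })

map-walk : ∀ {n} {G H : Graph n} → SpanningSubgraph G H → ∀ {x y k} → Walk G x y k → Walk H x y k
map-walk G⊆H [] = []
map-walk G⊆H (e ∷ p) = G⊆H e ∷ map-walk G⊆H p

Connected-mono : ∀ {n} {G H : Graph n} → SpanningSubgraph G H → Connected G → Connected H
Connected-mono G⊆H con x y with k , p ← con x y = k , map-walk G⊆H p

-- Irreducibility from a lower bound over all supergraphs

Realisable : ℕ → ℕ → Set₁
Realisable n b = ∃ λ (G : Graph n) → Connected G × Irreducible G × MetricDimension G b

irreducible : ∀ {n b} {G : Graph n} (W : Subset n) → Resolving G W → ∣ W ∣ ≤ b →
  (∀ {H} → SpanningSubgraph G H → ∀ W′ → Resolving H W′ → b ≤ ∣ W′ ∣) →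
  Irreducible G × MetricDimension G b
irreducible {b = b} {G} W res W≤b bound = (b , ((G , id , dim) , τ-min) , dim) , dim
  where
  dim : MetricDimension G b
  dim = (W , res , ℕ.≤-antisym W≤b (bound id W res)) ,
        λ { _ (W′ , res′ , refl) → bound id W′ res′ }
  τ-min : ∀ k → (∃ λ H → SpanningSubgraph G H × MetricDimension H k) → b ≤ k
  τ-min _ (H , G⊆H , (W′ , res′ , refl) , _) = bound G⊆H W′ res′

-- Cliques

Clique : ∀ {n r} → Graph n → (Fin r → Fin n) → Set
Clique G f = ∀ {i j} → i ≢ j → Adj G (f i) (f j)

parity : ℕ → Fin 2
parity zero = zero
parity (suc k) = opposite (parity k)

opposite-≢ : (x : Fin 2) → opposite x ≢ x
opposite-≢ zero ()
opposite-≢ (suc zero) ()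

-- Adjacent vertices have distances to a given vertex that differ by at most one, so the parity
-- alone tells whether these distances agree.
parity-injective : ∀ {k l} → k ≤ suc l → l ≤ suc k → parity k ≡ parity l → k ≡ l
parity-injective {k} {l} k≤ l≤ eq with ℕ.<-cmp k l
... | tri≈ _ k≡l _ = k≡l
... | tri< k<l _ _ with refl ← ℕ.≤-antisym l≤ k<l = contradiction (sym eq) (opposite-≢ (parity k))
... | tri> _ _ l<k with refl ← ℕ.≤-antisym k≤ l<k = contradiction eq (opposite-≢ (parity l))

-- The restriction of `g` to `W`, coded as a number so that the pigeonhole principle applies.
restrict : ∀ {n} (W : Subset n) → (Fin n → Fin 2) → Fin (2 ^ ∣ W ∣)
restrict [] g = zero
restrict (inside ∷ W) g = combine (g zero) (restrict W (g ∘ suc))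
restrict (outside ∷ W) g = restrict W (g ∘ suc)

restrict-injective : ∀ {n} (W : Subset n) g h → restrict W g ≡ restrict W h → ∀ {w} → w ∈ W → g w ≡ h w
restrict-injective (inside ∷ W) g h eq here = Fin.combine-injectiveˡ (g zero) _ (h zero) _ eq
restrict-injective (inside ∷ W) g h eq (there w∈W) =
  restrict-injective W (g ∘ suc) (h ∘ suc) (Fin.combine-injectiveʳ (g zero) _ (h zero) _ eq) w∈W
restrict-injective (outside ∷ W) g h eq (there w∈W) = restrict-injective W (g ∘ suc) (h ∘ suc) eq w∈W

-- With more than `2 ^ ∣ W ∣` clique vertices, two of them have the same parity of distance to every
-- member of `W`, hence the same distances, and stay unresolved.
clique-bound : ∀ {n r} {G : Graph n} → Connected G → {f : Fin r → Fin n} → Clique G f →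
  ∀ W → Resolving G W → r ≤ 2 ^ ∣ W ∣
clique-bound {n} {r} {G} con {f} clique W res with r ℕ.≤? 2 ^ ∣ W ∣
... | yes r≤ = r≤
... | no r≰ = ⊥-elim absurd
  where
  d : Fin r → Fin n → ℕ
  d i w = proj₁ (distance con (f i) w)
  d-dist : ∀ i w → IsMinimum (Walk G (f i) w) (d i w)
  d-dist i w = proj₂ (distance con (f i) w)
  d-adjacent : ∀ {i j} → i ≢ j → ∀ w → d i w ≤ suc (d j w)
  d-adjacent {i} {j} i≢j w = proj₂ (d-dist i w) _ (clique i≢j ∷ proj₁ (d-dist j w))
  absurd : ⊥
  absurd
    with i , j , i<j , eq ← Fin.pigeonhole (ℕ.≰⇒> r≰) (λ i → restrict W (parity ∘ d i))
    with i≢j ← Fin.<⇒≢ i<j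
    with w , w∈W , _ , _ , Di , Dj , neq ← res (f i) (f j) (Adj⇒≢ G (clique i≢j))
    with same ← parity-injective (d-adjacent i≢j w) (d-adjacent (≢-sym i≢j) w)
                  (restrict-injective W _ _ eq w∈W) =
    neq (trans (Distance-unique Di (finite (d-dist i w)))
        (trans (cong [_] same) (Distance-unique (finite (d-dist j w)) Dj)))

-- Graphs with a universal vertex

Universal : ∀ {n} → Graph n → Fin n → Set
Universal G c = ∀ {x} → x ≢ c → Adj G x c

Universal⇒Connected : ∀ {n} {G : Graph n} {c} → Universal G c → Connected G
Universal⇒Connected {G = G} {c} univ x y with x Fin.≟ c | y Fin.≟ c
... | yes refl | yes refl = 0 , []
... | yes refl | no y≢c = 1 , Graph.sym G (univ y≢c) ∷ []
... | no x≢c | yes refl = 1 , univ x≢c ∷ []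
... | no x≢c | no y≢c = 2 , univ x≢c ∷ Graph.sym G (univ y≢c) ∷ []

Splits : ∀ {n} → Graph n → Fin n → Fin n → Fin n → Set
Splits G w u v = (Adj G u w × ¬ Adj G v w) ⊎ (Adj G v w × ¬ Adj G u w)

-- The condition on locating sets: vertices outside `W` have distinct neighbourhoods in `W`. It
-- refers to adjacency only, hence is decidable by finite search.
Locating : ∀ {n} → Graph n → Subset n → Set
Locating G W = ∀ u v → u ≢ v → u ∉ W → v ∉ W → ∃ λ w → w ∈ W × Splits G w u v

locating? : ∀ {n} (G : Graph n) W → Dec (Locating G W)
locating? G W = Fin.all? λ u → Fin.all? λ v →
  ¬? (u Fin.≟ v) →-dec (¬? (u ∈? W) →-dec (¬? (v ∈? W) →-dec
    Fin.any? λ w → (w ∈? W) ×-dec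
      ((Graph.adj? G u w ×-dec ¬? (Graph.adj? G v w)) ⊎-dec
       (Graph.adj? G v w ×-dec ¬? (Graph.adj? G u w)))))

∈∉⇒≢ : ∀ {n} {W : Subset n} {x y} → x ∈ W → y ∉ W → y ≢ x
∈∉⇒≢ x∈W y∉W refl = y∉W x∈W

-- A member of `W` resolves itself from any other vertex. Outside `W`, a neighbour of `w` is at
-- distance 1, a non-neighbour at a distance other than 0 and 1.
Locating⇒Resolving : ∀ {n} {G : Graph n} → Connected G → ∀ {W} → Locating G W → Resolving G W
Locating⇒Resolving {G = G} con {W} loc u v u≢v with u ∈? W | v ∈? W
... | yes u∈W | _ = u , u∈W , self-resolves con u≢v
... | no _ | yes v∈W = v , v∈W , Resolves-sym (self-resolves con (≢-sym u≢v))
... | no u∉W | no v∉W with loc u v u≢v u∉W v∉W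
...   | w , w∈W , s = w , w∈W , resolve s
  where
  closer : ∀ {x y} → y ∉ W → Adj G x w → ¬ Adj G y w → Closer G w x y
  closer y∉W e ¬e = 1 , e ∷ [] ,
    λ { zero _ [] → y∉W w∈W ; (suc zero) _ (e′ ∷ []) → ¬e e′ ; (suc (suc _)) (s≤s ()) _ }
  resolve : Splits G w u v → Resolves G w u v
  resolve (inj₁ (e , ¬e)) = Closer⇒Resolves con (closer v∉W e ¬e)
  resolve (inj₂ (e , ¬e)) = Resolves-sym (Closer⇒Resolves con (closer u∉W e ¬e))

-- Vertices outside `W` are at distance 1 or 2 from those of `W`, so different distances mean that
-- exactly one of the two is adjacent.
Resolving⇒Locating : ∀ {n} {G : Graph n} {c} → Universal G c → ∀ {W} → Resolving G W → Locating G W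
Resolving⇒Locating {G = G} {c} univ {W} res u v u≢v u∉W v∉W
  with w , w∈W , d , e , Du , Dv , d≢e ← res u v u≢v = w , w∈W , split
  where
  -- Distinct non-adjacent vertices both differ from `c` and have it as a common neighbour.
  at-2 : ∀ {x} → x ∉ W → ¬ Adj G x w → Distance G x w [ 2 ]
  at-2 {x} x∉W ¬xw with x Fin.≟ c | w Fin.≟ c
  ... | yes refl | _ = contradiction (Graph.sym G (univ (≢-sym (∈∉⇒≢ w∈W x∉W)))) ¬xw
  ... | no x≢c | yes refl = contradiction (univ x≢c) ¬xw
  ... | no x≢c | no w≢c = distance-2 (∈∉⇒≢ w∈W x∉W) ¬xw (univ x≢c) (Graph.sym G (univ w≢c))
  equidistant : ∀ {k} → Distance G u w k → Distance G v w k → ⊥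
  equidistant Du′ Dv′ = d≢e (trans (Distance-unique Du Du′) (Distance-unique Dv′ Dv))
  split : Splits G w u v
  split with Graph.adj? G u w | Graph.adj? G v w
  ... | yes uw | yes vw = ⊥-elim (equidistant (distance-1 uw) (distance-1 vw))
  ... | yes uw | no ¬vw = inj₁ (uw , ¬vw)
  ... | no ¬uw | yes vw = inj₂ (vw , ¬uw)
  ... | no ¬uw | no ¬vw = ⊥-elim (equidistant (at-2 u∉W ¬uw) (at-2 v∉W ¬vw))

Locating-resp : ∀ {n} {G H : Graph n} → SpanningSubgraph G H → SpanningSubgraph H G →
  ∀ {W} → Locating G W → Locating H W
Locating-resp G⊆H H⊆G loc u v u≢v u∉W v∉W with loc u v u≢v u∉W v∉W
... | w , w∈W , inj₁ (e , ¬e) = w , w∈W , inj₁ (G⊆H e , ¬e ∘ H⊆G)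
... | w , w∈W , inj₂ (e , ¬e) = w , w∈W , inj₂ (G⊆H e , ¬e ∘ H⊆G)

-- Adding an edge

addEdge : ∀ {n} → Graph n → ∀ {u v : Fin n} → u ≢ v → Graph n
addEdge G {u} {v} u≢v = record
  { Adj = λ x y → Adj G x y ⊎ (x ≡ u × y ≡ v) ⊎ (x ≡ v × y ≡ u)
  ; sym = λ { (inj₁ e) → inj₁ (Graph.sym G e)
            ; (inj₂ (inj₁ (p , q))) → inj₂ (inj₂ (q , p))
            ; (inj₂ (inj₂ (p , q))) → inj₂ (inj₁ (q , p)) }
  ; irrefl = λ { x≡y (inj₁ e) → Graph.irrefl G x≡y e
               ; refl (inj₂ (inj₁ (refl , q))) → u≢v q
               ; refl (inj₂ (inj₂ (refl , q))) → u≢v (sym q) }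
  ; adj? = λ x y → Graph.adj? G x y ⊎-dec
      (((x Fin.≟ u) ×-dec (y Fin.≟ v)) ⊎-dec ((x Fin.≟ v) ×-dec (y Fin.≟ u)))
  }

∣p∪⁅x⁆∣≤1+∣p∣ : ∀ {n} (p : Subset n) x → ∣ p ∪ ⁅ x ⁆ ∣ ≤ suc ∣ p ∣
∣p∪⁅x⁆∣≤1+∣p∣ (inside ∷ p) zero rewrite ∪-identityʳ p = ℕ.n≤1+n _
∣p∪⁅x⁆∣≤1+∣p∣ (outside ∷ p) zero rewrite ∪-identityʳ p = ℕ.≤-refl
∣p∪⁅x⁆∣≤1+∣p∣ (inside ∷ p) (suc x) = s≤s (∣p∪⁅x⁆∣≤1+∣p∣ p x)
∣p∪⁅x⁆∣≤1+∣p∣ (outside ∷ p) (suc x) = ∣p∪⁅x⁆∣≤1+∣p∣ p x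

-- Outside W ∪ ⁅ z ⁆ the new edge is invisible from W when z is an endpoint of
-- it, provided that z is chosen outside W if possible.
Locating-addEdge : ∀ {n} {G : Graph n} {u v} (u≢v : u ≢ v) {W} → Locating G W →
  ∃ λ z → Locating (addEdge G u≢v) (W ∪ ⁅ z ⁆)
Locating-addEdge {n} {G} {u} {v} u≢v {W} loc = choose (u ∈? W)
  where
  extend : ∀ {z} →
    (∀ {x w} → x ∉ W ∪ ⁅ z ⁆ → w ∈ W → ¬ ((x ≡ u × w ≡ v) ⊎ (x ≡ v × w ≡ u))) →
    Locating (addEdge G u≢v) (W ∪ ⁅ z ⁆)
  extend unseen x y x≢y x∉ y∉ with loc x y x≢y (x∉ ∘ x∈p∪q⁺ ∘ inj₁) (y∉ ∘ x∈p∪q⁺ ∘ inj₁)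
  ... | w , w∈W , inj₁ (e , ¬e) = w , x∈p∪q⁺ (inj₁ w∈W) ,
        inj₁ (inj₁ e , λ { (inj₁ e′) → ¬e e′ ; (inj₂ new) → unseen y∉ w∈W new })
  ... | w , w∈W , inj₂ (e , ¬e) = w , x∈p∪q⁺ (inj₁ w∈W) ,
        inj₂ (inj₁ e , λ { (inj₁ e′) → ¬e e′ ; (inj₂ new) → unseen x∉ w∈W new })
  choose : Dec (u ∈ W) → ∃ λ z → Locating (addEdge G u≢v) (W ∪ ⁅ z ⁆)
  choose (yes u∈W) = v , extend
    λ { x∉ w∈W (inj₁ (refl , _)) → x∉ (x∈p∪q⁺ (inj₁ u∈W))
      ; x∉ w∈W (inj₂ (refl , _)) → x∉ (x∈p∪q⁺ (inj₂ (x∈⁅x⁆ v))) }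
  choose (no u∉W) = u , extend
    λ { x∉ w∈W (inj₁ (refl , _)) → x∉ (x∈p∪q⁺ (inj₂ (x∈⁅x⁆ u)))
      ; x∉ w∈W (inj₂ (_ , refl)) → u∉W w∈W }

-- Edge-maximal supergraphs

does-true : ∀ {A : Set} (a? : Dec A) → does a? ≡ inside → A
does-true (yes a) _ = a

-- Adjacency as a subset of the ordered pairs, so that search over subsets and well-founded
-- induction on them become available for graphs.
edgeSet : ∀ {n} → Graph n → Subset (n * n)
edgeSet {n} G = tabulate λ p → does (Graph.adj? G (quotient n p) (remainder {n} n p))

∈-edgeSet⁻ : ∀ {n} {G : Graph n} {p} → p ∈ edgeSet G → Adj G (quotient n p) (remainder {n} n p)
∈-edgeSet⁻ {n} {G} {p} p∈ =
  does-true (Graph.adj? G _ _) (trans (sym (lookup∘tabulate _ p)) ([]=⇒lookup p∈))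

∈-edgeSet⁺ : ∀ {n} {G : Graph n} {p} → Adj G (quotient n p) (remainder {n} n p) → p ∈ edgeSet G
∈-edgeSet⁺ {n} {G} {p} e =
  lookup⇒[]= p _ (trans (lookup∘tabulate _ p) (dec-true (Graph.adj? G _ _) e))

combine-∈-edgeSet⁺ : ∀ {n} {G : Graph n} {x y} → Adj G x y → combine x y ∈ edgeSet G
combine-∈-edgeSet⁺ {n} {G} {x} {y} e =
  ∈-edgeSet⁺ {G = G} (subst (uncurry (Adj G)) (sym (Fin.remQuot-combine x y)) e)

combine-∈-edgeSet⁻ : ∀ {n} {G : Graph n} {x y} → combine x y ∈ edgeSet G → Adj G x y
combine-∈-edgeSet⁻ {n} {G} {x} {y} c∈ =
  subst (uncurry (Adj G)) (Fin.remQuot-combine x y) (∈-edgeSet⁻ {G = G} c∈)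

-- Loops are discarded and the rest is symmetrised: every subset yields a graph, and every graph
-- arises up to equal adjacency.
fromEdgeSet : ∀ {n} → Subset (n * n) → Graph n
fromEdgeSet S = record
  { Adj = λ x y → x ≢ y × (combine x y ∈ S ⊎ combine y x ∈ S)
  ; sym = λ { (x≢y , e) → ≢-sym x≢y , swap e }
  ; irrefl = λ { x≡y (x≢y , _) → x≢y x≡y }
  ; adj? = λ x y → ¬? (x Fin.≟ y) ×-dec ((combine x y ∈? S) ⊎-dec (combine y x ∈? S))
  }

fromEdgeSet-edgeSet⁺ : ∀ {n} (G : Graph n) → SpanningSubgraph G (fromEdgeSet (edgeSet G))
fromEdgeSet-edgeSet⁺ G e = Adj⇒≢ G e , inj₁ (combine-∈-edgeSet⁺ {G = G} e)

fromEdgeSet-edgeSet⁻ : ∀ {n} (G : Graph n) → SpanningSubgraph (fromEdgeSet (edgeSet G)) G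
fromEdgeSet-edgeSet⁻ G (_ , inj₁ e) = combine-∈-edgeSet⁻ {G = G} e
fromEdgeSet-edgeSet⁻ G (_ , inj₂ e) = Graph.sym G (combine-∈-edgeSet⁻ {G = G} e)

edgeSet-⊂ : ∀ {n} {G H : Graph n} {u v} → SpanningSubgraph G H → Adj H u v → ¬ Adj G u v →
  edgeSet G ⊂ edgeSet H
edgeSet-⊂ {G = G} {H} G⊆H e ¬e =
  (λ p∈ → ∈-edgeSet⁺ {G = H} (G⊆H (∈-edgeSet⁻ {G = G} p∈))) ,
  _ , combine-∈-edgeSet⁺ {G = H} e , ¬e ∘ combine-∈-edgeSet⁻ {G = G}

edgeSet-⊂⇒SpanningSubgraph : ∀ {n} {G H : Graph n} → edgeSet G ⊂ edgeSet H → SpanningSubgraph G H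
edgeSet-⊂⇒SpanningSubgraph {G = G} {H} (G⊆H , _) e =
  combine-∈-edgeSet⁻ {G = H} (G⊆H (combine-∈-edgeSet⁺ {G = G} e))

module _ {n} (P : Graph n → Set) (P? : ∀ G → Dec (P G))
  (P-resp : ∀ {G H} → SpanningSubgraph G H → SpanningSubgraph H G → P G → P H) where

  -- As long as a strictly larger graph satisfies `P`, the search moves on to it; strict growth of
  -- the edge set ends this.
  maximalSupergraph : ∀ G → P G → ∃ λ M → SpanningSubgraph G M × P M ×
    (∀ {H u v} → SpanningSubgraph M H → Adj H u v → ¬ Adj M u v → ¬ P H)
  maximalSupergraph G PG = search G PG (⊃-wellFounded (edgeSet G))
    where
    search : ∀ G → P G → Acc _⊃_ (edgeSet G) → ∃ λ M → SpanningSubgraph G M × P M ×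
      (∀ {H u v} → SpanningSubgraph M H → Adj H u v → ¬ Adj M u v → ¬ P H)
    search G PG (acc rec)
      with anySubset? (λ S → (edgeSet G ⊂? edgeSet (fromEdgeSet {n} S)) ×-dec P? (fromEdgeSet S))
    ... | yes (S , G⊂S , PS)
      with M , S⊆M , PM , max ← search (fromEdgeSet S) PS (rec G⊂S) =
        M , S⊆M ∘ edgeSet-⊂⇒SpanningSubgraph {G = G} {fromEdgeSet S} G⊂S , PM , max
    -- The failed search speaks of coded graphs only, so `H` is replaced by its copy
    -- `fromEdgeSet (edgeSet H)`, which satisfies `P` by `P-resp`.
    ... | no none = G , id , PG , λ {H} G⊆H e ¬e PH →
        let to = fromEdgeSet-edgeSet⁺ H ; from = fromEdgeSet-edgeSet⁻ H in
        none (edgeSet H ,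
              edgeSet-⊂ {G = G} {fromEdgeSet (edgeSet H)} (to ∘ G⊆H) (to e) ¬e ,
              P-resp to from PH)

-- Complete graphs and the case of small order

∃∉ : ∀ {n} (W : Subset n) → ∣ W ∣ < n → ∃ λ x → x ∉ W
∃∉ (outside ∷ W) _ = zero , λ ()
∃∉ (inside ∷ W) (s≤s W<n) with x , x∉W ← ∃∉ W W<n = suc x , λ { (there x∈W) → x∉W x∈W }

∃∉² : ∀ {n} (W : Subset n) → suc ∣ W ∣ < n → ∃ λ x → ∃ λ y → x ≢ y × x ∉ W × y ∉ W
∃∉² (outside ∷ W) (s≤s W<n) with y , y∉W ← ∃∉ W W<n =
  zero , suc y , (λ ()) , (λ ()) , λ { (there y∈W) → y∉W y∈W }
∃∉² (inside ∷ W) (s≤s W<n) with x , y , x≢y , x∉W , y∉W ← ∃∉² W W<n =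
  suc x , suc y , (λ { refl → x≢y refl }) ,
  (λ { (there x∈W) → x∉W x∈W }) , λ { (there y∈W) → y∉W y∈W }

-- Two vertices outside `W` would both be adjacent to all of `W`, so nothing would split them.
complete-bound : ∀ {n} {G : Graph n} → (∀ {x y} → x ≢ y → Adj G x y) →
  ∀ W → Locating G W → n ≤ suc ∣ W ∣
complete-bound {n} complete W loc with n ℕ.≤? suc ∣ W ∣
... | yes n≤ = n≤
... | no n≰ with x , y , x≢y , x∉W , y∉W ← ∃∉² W (ℕ.≰⇒> n≰) with loc x y x≢y x∉W y∉W
...   | w , w∈W , inj₁ (_ , ¬e) = contradiction (complete (∈∉⇒≢ w∈W y∉W)) ¬e
...   | w , w∈W , inj₂ (_ , ¬e) = contradiction (complete (∈∉⇒≢ w∈W x∉W)) ¬e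

complete? : ∀ {n} (G : Graph n) →
  (∃ λ u → ∃ λ v → u ≢ v × ¬ Adj G u v) ⊎ (∀ {x y} → x ≢ y → Adj G x y)
complete? G with Fin.any? (λ u → Fin.any? λ v → ¬? (u Fin.≟ v) ×-dec ¬? (Graph.adj? G u v))
... | yes missing = inj₁ missing
... | no none = inj₂ λ {x} {y} x≢y → complete x≢y (Graph.adj? G x y)
  where
  complete : ∀ {x y} → x ≢ y → Dec (Adj G x y) → Adj G x y
  complete x≢y (yes e) = e
  complete x≢y (no ¬e) = contradiction (_ , _ , x≢y , ¬e) none

LocatedBy : ∀ {n} → ℕ → Graph n → Set
LocatedBy b G = ∃ λ W → ∣ W ∣ ≤ b × Locating G W

universal-irreducible : ∀ {n b} {G : Graph n} {c} → Universal G c → LocatedBy b G → b < n →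
  Realisable n b
universal-irreducible {n} {b} {G} univ located b<n
  -- The universal vertex survives in every supergraph of `G`; there `LocatedBy b` is a decidable
  -- form of having metric dimension at most `b`.
  with M , G⊆M , (W , W≤b , loc) , max ← maximalSupergraph (LocatedBy b)
         (λ G → anySubset? λ W → (∣ W ∣ ℕ.≤? b) ×-dec locating? G W)
         (λ { {G} {H} G⊆H H⊆G (W , W≤b , loc) → W , W≤b , Locating-resp {G = G} {H} G⊆H H⊆G loc }) G located =
  M , con , irreducible W (Locating⇒Resolving con loc) W≤b bound
  where
  con : Connected M
  con = Universal⇒Connected (G⊆M ∘ univ)
  bound : ∀ {H} → SpanningSubgraph M H → ∀ W′ → Resolving H W′ → b ≤ ∣ W′ ∣
  bound {H} M⊆H W′ res with b ℕ.≤? ∣ W′ ∣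
  ... | yes b≤ = b≤
  ... | no b≰ with loc′ ← Resolving⇒Locating {G = H} (M⊆H ∘ G⊆M ∘ univ) res | complete? H
  ...   | inj₂ complete = s≤s⁻¹ (ℕ.≤-trans b<n (complete-bound {G = H} complete W′ loc′))
  -- The edge `uv` is missing from `M` too, and `W′` with one more vertex has at most `b` elements,
  -- against maximality.
  ...   | inj₁ (u , v , u≢v , ¬uv) with z , loc″ ← Locating-addEdge {G = H} u≢v loc′ =
    contradiction
      (W′ ∪ ⁅ z ⁆ , ℕ.≤-trans (∣p∪⁅x⁆∣≤1+∣p∣ W′ z) (ℕ.≰⇒> b≰) , loc″)
      (max {addEdge H u≢v} (inj₁ ∘ M⊆H) (inj₂ (inj₁ (refl , refl))) (¬uv ∘ M⊆H))

-- The core graph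

finToFun-injective : ∀ {m} n (i j : Fin (m ^ n)) → (∀ k → finToFun {m} {n} i k ≡ finToFun j k) → i ≡ j
finToFun-injective zero zero zero _ = refl
finToFun-injective {m} (suc n) i j eq =
  trans (sym (Fin.combine-remQuot {m} (m ^ n) i))
    (trans (cong₂ combine (eq zero) (finToFun-injective n _ _ (eq ∘ suc)))
      (Fin.combine-remQuot {m} (m ^ n) j))

initial : ∀ b r → Subset (b + r)
initial zero r = Subset.⊥
initial (suc b) r = inside ∷ initial b r

∣initial∣ : ∀ b r → ∣ initial b r ∣ ≡ b
∣initial∣ zero r = ∣⊥∣≡0 r
∣initial∣ (suc b) r = cong suc (∣initial∣ b r)

↑ˡ-∈-initial : ∀ {b} r (i : Fin b) → i ↑ˡ r ∈ initial b r
↑ˡ-∈-initial r zero = here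
↑ˡ-∈-initial r (suc i) = there (↑ˡ-∈-initial r i)

module Core (b r : ℕ) (r≤ : suc r ≤ 2 ^ b) where

  -- The `b` binary digits of `c`, which determine the neighbours of the clique vertex `c` outside
  -- the clique; `r≤` makes these digit strings distinct.
  bit : Fin (suc r) → Fin b → Fin 2
  bit c = finToFun (inject≤ c r≤)

  bit-separates : ∀ {c d} → c ≢ d → ∃ λ i → bit c i ≢ bit d i
  bit-separates {c} {d} c≢d = Fin.¬∀⟶∃¬ b _ (λ i → bit c i Fin.≟ bit d i)
    λ same → c≢d (Fin.inject≤-injective r≤ r≤ c d (finToFun-injective b _ _ same))

  private
    Part : Set
    Part = Fin b ⊎ Fin (suc r)

    -- Comparing with bit zero, instead of a fixed value, makes zero universal.
    _~_ : Part → Part → Set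
    inj₁ i ~ inj₁ j = ⊥
    inj₁ i ~ inj₂ c = bit c i ≡ bit zero i
    inj₂ c ~ inj₁ i = bit c i ≡ bit zero i
    inj₂ c ~ inj₂ d = c ≢ d

    ~-sym : ∀ s t → s ~ t → t ~ s
    ~-sym (inj₁ i) (inj₂ c) e = e
    ~-sym (inj₂ c) (inj₁ i) e = e
    ~-sym (inj₂ c) (inj₂ d) e = ≢-sym e

    ~-irrefl : ∀ s → ¬ s ~ s
    ~-irrefl (inj₂ c) c≢c = c≢c refl

    _~?_ : ∀ s t → Dec (s ~ t)
    inj₁ i ~? inj₁ j = no id
    inj₁ i ~? inj₂ c = bit c i Fin.≟ bit zero i
    inj₂ c ~? inj₁ i = bit c i Fin.≟ bit zero i
    inj₂ c ~? inj₂ d = ¬? (c Fin.≟ d)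

  core : Graph (b + suc r)
  core = record
    { Adj = λ x y → splitAt b x ~ splitAt b y
    ; sym = λ {x} {y} → ~-sym (splitAt b x) (splitAt b y)
    ; irrefl = λ { {x} refl → ~-irrefl (splitAt b x) }
    ; adj? = λ x y → splitAt b x ~? splitAt b y
    }

  private
    adj : ∀ {x y s t} → splitAt b x ≡ s → splitAt b y ≡ t → s ~ t → Adj core x y
    adj refl refl e = e

    adj⁻ : ∀ {x y s t} → splitAt b x ≡ s → splitAt b y ≡ t → Adj core x y → s ~ t
    adj⁻ refl refl e = e

  core-clique : Clique core (b ↑ʳ_)
  core-clique i≢j = adj (Fin.splitAt-↑ʳ b _ _) (Fin.splitAt-↑ʳ b _ _) i≢j

  core-universal : Universal core (b ↑ʳ zero)
  core-universal {x} x≢ with splitAt b x in eq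
  ... | inj₁ i rewrite Fin.splitAt-↑ʳ b (suc r) zero = refl
  ... | inj₂ c rewrite Fin.splitAt-↑ʳ b (suc r) zero = λ { refl → x≢ (sym (Fin.splitAt⁻¹-↑ʳ eq)) }

  private
    ∉-initial : ∀ {x} → x ∉ initial b (suc r) → ∃ λ c → splitAt b x ≡ inj₂ c
    ∉-initial {x} x∉ with splitAt b x in eq
    ... | inj₁ i = contradiction (subst (_∈ _) (Fin.splitAt⁻¹-↑ˡ eq) (↑ˡ-∈-initial (suc r) i)) x∉
    ... | inj₂ c = c , refl

    -- Only one digit differs from `z`, so comparison with `bit zero` loses no information.
    agree : (x y z : Fin 2) → x ≢ z → y ≢ z → x ≡ y
    agree zero zero _ _ _ = refl
    agree (suc zero) (suc zero) _ _ _ = refl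
    agree zero (suc zero) zero x≢z _ = contradiction refl x≢z
    agree zero (suc zero) (suc zero) _ y≢z = contradiction refl y≢z
    agree (suc zero) zero zero _ y≢z = contradiction refl y≢z
    agree (suc zero) zero (suc zero) x≢z _ = contradiction refl x≢z

  -- The vertices outside `initial` form the clique. Two of them differ in some digit `i`, and
  -- vertex `i` is adjacent to exactly one of the two.
  core-locating : Locating core (initial b (suc r))
  core-locating u v u≢v u∉ v∉
    with c , u≡ ← ∉-initial u∉ | d , v≡ ← ∉-initial v∉
    with i , ci≢di ← bit-separates {c} {d} (λ { refl →
           u≢v (trans (sym (Fin.splitAt⁻¹-↑ʳ u≡)) (Fin.splitAt⁻¹-↑ʳ v≡)) }) =
    i ↑ˡ suc r , ↑ˡ-∈-initial (suc r) i , split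
    where
    i≡ : splitAt b (i ↑ˡ suc r) ≡ inj₁ i
    i≡ = Fin.splitAt-↑ˡ b i (suc r)
    split : Splits core (i ↑ˡ suc r) u v
    split with bit c i Fin.≟ bit zero i | bit d i Fin.≟ bit zero i
    ... | yes p | yes q = contradiction (trans p (sym q)) ci≢di
    ... | yes p | no ¬q = inj₁ (adj u≡ i≡ p , ¬q ∘ adj⁻ v≡ i≡)
    ... | no ¬p | yes q = inj₂ (adj v≡ i≡ q , ¬p ∘ adj⁻ u≡ i≡)
    ... | no ¬p | no ¬q = contradiction (agree _ _ _ ¬p ¬q) ci≢di

-- Appending a pendant vertex

module Pendant {n} (G : Graph n) (w : Fin n) where

  private
    _~_ : Fin (suc n) → Fin (suc n) → Set
    zero ~ zero = ⊥
    zero ~ suc y = y ≡ w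
    suc x ~ zero = x ≡ w
    suc x ~ suc y = Adj G x y

    ~-sym : ∀ x y → x ~ y → y ~ x
    ~-sym zero (suc y) e = e
    ~-sym (suc x) zero e = e
    ~-sym (suc x) (suc y) e = Graph.sym G e

    ~-irrefl : ∀ x → ¬ x ~ x
    ~-irrefl (suc x) e = Graph.irrefl G refl e

    _~?_ : ∀ x y → Dec (x ~ y)
    zero ~? zero = no id
    zero ~? suc y = y Fin.≟ w
    suc x ~? zero = x Fin.≟ w
    suc x ~? suc y = Graph.adj? G x y

  pendant : Graph (suc n)
  pendant = record
    { Adj = _~_
    ; sym = λ {x} {y} → ~-sym x y
    ; irrefl = λ { {x} refl → ~-irrefl x }
    ; adj? = _~?_
    }

  lift-walk : ∀ {x y k} → Walk G x y k → Walk pendant (suc x) (suc y) k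
  lift-walk [] = []
  lift-walk (e ∷ p) = e ∷ lift-walk p

  lift-walk-zero : ∀ {x k} → Walk G x w k → Walk pendant (suc x) zero (suc k)
  lift-walk-zero [] = refl ∷ []
  lift-walk-zero (e ∷ p) = e ∷ lift-walk-zero p

  -- The new vertex gives no shortcut between old ones.
  project-walk : ∀ {x y k} → Walk pendant (suc x) (suc y) k → ∃ λ j → j ≤ k × Walk G x y j
  project-walk [] = 0 , z≤n , []
  project-walk (_∷_ {y = suc _} e p) with j , j≤k , q ← project-walk p = suc j , s≤s j≤k , e ∷ q
  -- A visit to the new vertex enters from `w` and returns to `w`; both steps are dropped.
  project-walk (_∷_ {y = zero} refl (_∷_ {y = suc _} refl p)) with j , j≤k , q ← project-walk p =
    j , ℕ.≤-trans j≤k (ℕ.m≤n+m _ 2) , q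

  -- The last step to the new vertex comes from `w`; the walk is cut at its first arrival there, so
  -- at least one step is saved.
  project-walk-zero : ∀ {x k} → Walk pendant (suc x) zero k → ∃ λ j → j < k × Walk G x w j
  project-walk-zero (_∷_ {y = zero} refl p) = 0 , z<s , []
  project-walk-zero (_∷_ {y = suc _} e p) with j , j<k , q ← project-walk-zero p =
    suc j , s<s j<k , e ∷ q

  lift-Closer : ∀ {x u v} → Closer G x u v → Closer pendant (suc x) (suc u) (suc v)
  lift-Closer (k , p , far) = k , lift-walk p , λ j j≤k q →
    let i , i≤j , q′ = project-walk q in far i (ℕ.≤-trans i≤j j≤k) q′

  lift-Closer-zero : ∀ {u v} → Closer G w u v → Closer pendant zero (suc u) (suc v)
  lift-Closer-zero (k , p , far) = suc k , lift-walk-zero p , λ j j≤ q →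
    let i , i<j , q′ = project-walk-zero q in far i (s≤s⁻¹ (ℕ.≤-trans i<j j≤)) q′

  pendant-connected : Connected G → Connected pendant
  pendant-connected con zero zero = 0 , []
  pendant-connected con zero (suc y) with k , p ← con w y = suc k , refl ∷ lift-walk p
  pendant-connected con (suc x) zero with k , p ← con x w = suc k , lift-walk-zero p
  pendant-connected con (suc x) (suc y) with k , p ← con x y = k , lift-walk p

  -- The new vertex takes the place of `w`: from old vertices its distance is one more than that of
  -- `w`, so it resolves the same old pairs. The other members of `W` keep their distances.
  pendant-resolving : Connected G → ∀ {W} → Resolving G W → Resolving pendant (inside ∷ (W - w))
  pendant-resolving con res zero zero 0≢0 = contradiction refl 0≢0
  pendant-resolving con res zero (suc v) 0≢v =
    zero , here , self-resolves (pendant-connected con) 0≢v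
  pendant-resolving con res (suc u) zero u≢0 =
    zero , here , Resolves-sym (self-resolves (pendant-connected con) (≢-sym u≢0))
  pendant-resolving con {W} res (suc u) (suc v) u≢v
    with x , x∈W , r ← res u v (u≢v ∘ cong suc) with x Fin.≟ w | Resolves⇒Closer r
  ... | yes refl | inj₁ c = zero , here , Closer⇒Resolves (pendant-connected con) (lift-Closer-zero c)
  ... | yes refl | inj₂ c =
    zero , here , Resolves-sym (Closer⇒Resolves (pendant-connected con) (lift-Closer-zero c))
  ... | no x≢w | inj₁ c = suc x , there (x∈p∧x≢y⇒x∈p-y x∈W x≢w) ,
    Closer⇒Resolves (pendant-connected con) (lift-Closer c)
  ... | no x≢w | inj₂ c = suc x , there (x∈p∧x≢y⇒x∈p-y x∈W x≢w) ,
    Resolves-sym (Closer⇒Resolves (pendant-connected con) (lift-Closer c))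

-- Resolved cliques and the case of large order

record ResolvedClique (n b r : ℕ) : Set₁ where
  field
    graph     : Graph n
    connected : Connected graph
    vertices  : Fin r → Fin n
    clique    : Clique graph vertices
    resolver  : Subset n
    nonempty  : Subset.Nonempty resolver
    size      : ∣ resolver ∣ ≤ b
    resolving : Resolving graph resolver

extend-clique : ∀ {n b r} → ResolvedClique n b r → ResolvedClique (suc n) b r
extend-clique Q = let open ResolvedClique Q in let w , w∈W = nonempty in
  let open Pendant graph w in record
    { graph     = pendant
    ; connected = pendant-connected connected
    ; vertices  = suc ∘ vertices
    ; clique    = clique
    ; resolver  = inside ∷ (resolver - w)
    -- The new vertex is the next point of attachment, so that repetition grows a path.
    ; nonempty  = zero , here
    ; size      = ℕ.≤-trans (x∈p⇒∣p-x∣<∣p∣ w∈W) size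
    ; resolving = pendant-resolving connected resolving
    }

extend-clique-by : ∀ t {n b r} → ResolvedClique n b r → ResolvedClique (t + n) b r
extend-clique-by zero Q = Q
extend-clique-by (suc t) Q = extend-clique (extend-clique-by t Q)

-- The clique survives in every supergraph, where at most `b` vertices could resolve a clique of
-- order at most `2 ^ b` only.
clique-irreducible : ∀ {n b} → ResolvedClique n (suc b) (suc (2 ^ b)) →
  Realisable n (suc b)
clique-irreducible {n} {b} Q = graph , connected , irreducible resolver resolving size bound
  where
  open ResolvedClique Q
  bound : ∀ {H} → SpanningSubgraph graph H → ∀ W → Resolving H W → suc b ≤ ∣ W ∣
  bound {H} G⊆H W res with suc b ℕ.≤? ∣ W ∣
  ... | yes b< = b<
  ... | no b≮ = contradiction
    (clique-bound (Connected-mono G⊆H connected) {vertices} (λ i≢j → G⊆H (clique i≢j)) W res)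
    (ℕ.<⇒≱ (s≤s (ℕ.^-monoʳ-≤ 2 (s≤s⁻¹ (ℕ.≰⇒> b≮)))))

2^b<2^[1+b] : ∀ b → 2 ^ b < 2 ^ suc b
2^b<2^[1+b] b = ℕ.^-monoʳ-< 2 (s<s z<s) (ℕ.n<1+n b)

resolvedClique : ∀ b → ResolvedClique (suc b + suc (2 ^ b)) (suc b) (suc (2 ^ b))
resolvedClique b = record
  { graph     = core
  ; connected = connected
  ; vertices  = suc b ↑ʳ_
  ; clique    = C.core-clique
  ; resolver  = initial (suc b) (suc (2 ^ b))
  ; nonempty  = zero , here
  ; size      = ℕ.≤-reflexive (∣initial∣ (suc b) (suc (2 ^ b)))
  ; resolving = Locating⇒Resolving connected C.core-locating
  }
  where
  module C = Core (suc b) (2 ^ b) (2^b<2^[1+b] b)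
  open C using (core)
  connected : Connected core
  connected = Universal⇒Connected C.core-universal

-- The two ranges of the order

theorem4p6 : (n : ℕ) → 2 ≤ n → (b : ℕ) → 1 ≤ b → b ≤ n ∸ 1 →
    ∃ λ (G : Graph n) → Connected G × Irreducible G × MetricDimension G b
theorem4p6 (suc n) _ (suc b) _ b<n with suc n ℕ.≤? suc b + 2 ^ suc b
-- The vertices beyond the `suc b` resolving ones number `suc r`; cancelling `suc b` in `n≤` shows
-- that enough digit strings exist for them.
... | yes n≤ with r , refl ← ℕ.m≤n⇒∃[o]m+o≡n b<n =
  subst (λ k → Realisable k (suc b))
    (ℕ.+-suc (suc b) r)
    (universal-irreducible {G = core} core-universal
      (initial (suc b) (suc r) , ℕ.≤-reflexive (∣initial∣ (suc b) (suc r)) , core-locating)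
      (ℕ.m<m+n (suc b) z<s))
  where
  open Core (suc b) r
    (ℕ.+-cancelˡ-≤ (suc b) _ _ (subst (_≤ suc b + 2 ^ suc b) (sym (ℕ.+-suc (suc b) r)) n≤))
... | no n≰
  -- Here `t` is the length of the appended path. The core fits since `suc (2 ^ b)` is at most
  -- `2 ^ suc b`.
  with t , eq ← ℕ.m≤n⇒∃[o]m+o≡n {suc b + suc (2 ^ b)} {suc n}
         (ℕ.≤-trans (ℕ.+-monoʳ-≤ (suc b) (2^b<2^[1+b] b)) (ℕ.<⇒≤ (ℕ.≰⇒> n≰))) =
  subst (λ k → Realisable k (suc b))
    (trans (ℕ.+-comm t _) eq)
    (clique-irreducible (extend-clique-by t (resolvedClique b)))
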